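{- Let $a=(\Sigma,\vdash)$ and $a'=(\Sigma',\vdash')$ be algebraizable logics and let $\mathbb{G}=(h:a\to a',\bar\rho)$ be a Glivenko's context, with lifting $\rho_X:F(\Sigma')(X)\to F(\Sigma)(X)$ of $\bar\rho_X$. Then for every $\Gamma'\cup\{\varphi'\}\subseteq F(\Sigma')(X)$, $$\rho_X[\Gamma']\vdash\rho_X(\varphi')\iff\Gamma'\vdash'\varphi'.$$
   Context: **Logics.** A signature is a sequence $\Sigma=(\Sigma_n)_{n\in\mathbb{N}}$ of pairwise disjoint sets ($\Sigma_n$: the $n$-ary connectives). $X=\{x_0,x_1,\dots\}$ is a fixed countable set of variables, $F(\Sigma)=F(\Sigma)(X)$ is the absolutely free $\Sigma$-algebra (set of formulas) on $X$, and $F(\Sigma)[n]$ is the set of formulas whose variables are exactly $x_0,\dots,x_{n-1}$. A logic is a pair $a=(\Sigma,\vdash)$ with $\vdash\subseteq\mathcal P(F(\Sigma))\times F(\Sigma)$ a reflexive, monotone, finitary, structural (substitution-invariant) relation satisfying cut. A flexible morphism $f:\Sigma\to\Sigma'$ is a family of functions $\Sigma_n\to F(\Sigma')[n]$; it extends to $\check f:F(\Sigma)\to F(\Sigma')$ by $\check f(x)=x$ for $x\in X$ and $\check f(c_n(\psi_0,\dots,\psi_{n-1}))=f(c_n)[x_0|\check f(\psi_0),\dots,x_{n-1}|\check f(\psi_{n-1})]$. A flexible translation $f:(\Sigma,\vdash)\to(\Sigma',\vdash')$ is a flexible morphism such that $\Gamma\vdash\psi$ implies $\check f[\Gamma]\vdash'\check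 f(\psi)$. **Algebraizable logics** (Blok–Pigozzi). For a class $K$ of $\Sigma$-algebras, $\models_K$ is the equational consequence of $K$. A logic $a=(\Sigma,\vdash)$ is algebraizable if there are a class $K$, a finite set $\tau(p)=\{(\varepsilon^j(p),\delta^j(p))\}_{j}$ of equations in one variable and a finite set $\Delta(p,q)$ of formulas in two variables such that $\Gamma\vdash\varphi$ iff $\bigcup_{\gamma\in\Gamma}\tau(\gamma)\models_K\tau(\varphi)$, and $\varphi\equiv\psi$ is interderivable under $\models_K$ with $\tau(\varphi\Delta\psi)$. Then $(\tau,\Delta)$ is an algebraizing pair, and there is a unique quasivariety $QV(a)$ that can serve as $K$. $\varphi/\Delta=[\varphi]=\{\psi:\ \vdash\varphi\Delta\psi\}$ (independent of the choice of $\Delta$); $F(\Sigma)/\Delta$ is the free $QV(a)$-algebra on $X$. $\mathcal A_f$ is the category of algebraizable logics and flexible translations preserving algebraizing pairs, i.e. sending an algebraizing pair $(\tau,\Delta)$ of the source to an algebraizing pair $(\check f(\tau),\check f(\Delta))$ of the target. **Functors on algebras.** For $h:a\to a'$ in $\mathcal A_f$ and a $\Sigma'$-algebra $M$, $h^\star(M)$ is the $\Sigma$-algebra on the same set with $c_n^{h^\star(M)}=h(c_n)^M$, and $h^\star$ is the identity on maps. It restricts to $h^\star{\restriction}:QV(a')\to QV(a)$, which has a left adjoint, written $L_h:QV(a)\to QV(a')$, with unit $\bar\partial:Id\Rightarrow h^\star{\restriction}\circ L_h$. One identifies $L_h(F(\Sigma)/\Delta)$ with $F(\Sigma')/\Delta'$,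 so that the unit at $F(\Sigma)/\Delta$ is $\bar\partial_X:F(\Sigma)/\Delta\to h^\star(F(\Sigma')/\Delta')$, $[\theta]\mapsto[\check h(\theta)]$. **Glivenko's context.** A pair $\mathbb{G}=(h:a\to a',\bar\rho)$ with $h\in\mathcal A_f(a,a')$ and $\bar\rho:h^\star{\restriction}\circ L_h\Rightarrow Id$ a natural transformation (of endofunctors of $QV(a)$) which is a section of the unit: $\bar\partial_M\circ\bar\rho_M=id$ for all $M\in QV(a)$. Write $\bar\rho_X:h^\star(F(\Sigma')/\Delta')\to F(\Sigma)/\Delta$ for its component at $F(\Sigma)/\Delta$. A lifting $\rho_X:F(\Sigma')(X)\to F(\Sigma)(X)$ of $\bar\rho_X$ is any (chosen) function with $[\rho_X(\theta')]=\bar\rho_X([\theta'])$ for all $\theta'\in F(\Sigma')(X)$. -}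

module Defs where

open import Level using (Level; _⊔_) renaming (suc to lsuc)
open import Data.Nat.Base using (ℕ)
open import Data.Fin.Base using (Fin; zero; suc)
open import Data.Product.Base using (Σ; Σ-syntax; ∃; ∃-syntax; _×_; _,_; proj₁; proj₂)
open import Data.List.Base using (List; []; _∷_; map; concatMap)
open import Data.List.Membership.Propositional using (find) renaming (_∈_ to _∈ˡ_)
open import Data.List.Membership.Propositional.Properties
  using (∈-map⁺; ∈-map⁻; ∈-concatMap⁺; ∈-concatMap⁻)
open import Data.List.Relation.Unary.Any using (here; there)
import Data.List.Relation.Unary.Any as Any
open import Data.List.Relation.Unary.All using (All)
import Data.List.Relation.Unary.All as All
open import Data.Vec.Base as Vec using (Vec; []; _∷_; lookup)
open import Data.Vec.Properties using (lookup-map; map-id; map-∘)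
open import Data.List.Relation.Unary.All.Properties using (map⁺)
import Data.Vec.Relation.Unary.Any as VecAny
open import Data.Vec.Relation.Binary.Pointwise.Inductive as PW
  using (Pointwise; []; _∷_; Pointwise-≡⇒≡)
open import Function.Base using (_∘_; id)
open import Function.Bundles using (_⇔_; mk⇔; Equivalence)
open import Relation.Binary.Bundles using (Setoid)
open import Relation.Binary.Structures using (IsEquivalence)
open import Relation.Binary.PropositionalEquality
  using (_≡_; refl; sym; trans; cong; cong₂; subst; setoid)
open import Relation.Unary using (Pred; _∈_; _⊆_; ｛_｝)
open import Relation.Unary.Polymorphic using (∅)

private
  variable
    ℓ o o′ m m′ e e′ : Level

record Category (o m e : Level) : Set (lsuc (o ⊔ m ⊔ e)) where
  field
    Obj       : Set o
    Hom       : Obj → Obj → Set m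
    _≈_       : ∀ {A B} → Hom A B → Hom A B → Set e
    idₘ       : ∀ A → Hom A A
    _⊙_       : ∀ {A B C} → Hom B C → Hom A B → Hom A C
    equiv     : ∀ {A B} → IsEquivalence (_≈_ {A} {B})
    ⊙-resp-≈  : ∀ {A B C} {f f′ : Hom B C} {g g′ : Hom A B} →
                f ≈ f′ → g ≈ g′ → (f ⊙ g) ≈ (f′ ⊙ g′)
    identityˡ : ∀ {A B} (f : Hom A B) → (idₘ B ⊙ f) ≈ f
    identityʳ : ∀ {A B} (f : Hom A B) → (f ⊙ idₘ A) ≈ f
    assoc     : ∀ {A B C D} (f : Hom C D) (g : Hom B C) (h : Hom A B) →
                ((f ⊙ g) ⊙ h) ≈ (f ⊙ (g ⊙ h))

record Functor (𝒞 : Category o m e) (𝒟 : Category o′ m′ e′) :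
               Set (o ⊔ m ⊔ e ⊔ o′ ⊔ m′ ⊔ e′) where
  private
    module C = Category 𝒞
    module D = Category 𝒟
  field
    F₀       : C.Obj → D.Obj
    F₁       : ∀ {A B} → C.Hom A B → D.Hom (F₀ A) (F₀ B)
    F-resp-≈ : ∀ {A B} {f g : C.Hom A B} → f C.≈ g → F₁ f D.≈ F₁ g
    F-id     : ∀ A → F₁ (C.idₘ A) D.≈ D.idₘ (F₀ A)
    F-⊙      : ∀ {A B C} (f : C.Hom B C) (g : C.Hom A B) →
               F₁ (f C.⊙ g) D.≈ (F₁ f D.⊙ F₁ g)

Id : (𝒞 : Category o m e) → Functor 𝒞 𝒞
Id 𝒞 = record
  { F₀       = id
  ; F₁       = id
  ; F-resp-≈ = id
  ; F-id     = λ A → IsEquivalence.refl equiv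
  ; F-⊙      = λ f g → IsEquivalence.refl equiv
  }
  where open Category 𝒞

infixr 9 _∘F_

_∘F_ : {o″ m″ e″ : Level} {𝒞 : Category o m e} {𝒟 : Category o′ m′ e′}
       {ℰ : Category o″ m″ e″} → Functor 𝒟 ℰ → Functor 𝒞 𝒟 → Functor 𝒞 ℰ
_∘F_ {ℰ = ℰ} G F = record
  { F₀       = G.F₀ ∘ F.F₀
  ; F₁       = G.F₁ ∘ F.F₁
  ; F-resp-≈ = G.F-resp-≈ ∘ F.F-resp-≈
  ; F-id     = λ A → IsEquivalence.trans equiv (G.F-resp-≈ (F.F-id A)) (G.F-id (F.F₀ A))
  ; F-⊙      = λ f g → IsEquivalence.trans equiv (G.F-resp-≈ (F.F-⊙ f g)) (G.F-⊙ (F.F₁ f) (F.F₁ g))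
  }
  where
    open Category ℰ
    module F = Functor F
    module G = Functor G

infix 4 _⇒_ _⊣_

record _⇒_ {𝒞 : Category o m e} {𝒟 : Category o′ m′ e′} (F G : Functor 𝒞 𝒟) :
           Set (o ⊔ m ⊔ m′ ⊔ e′) where
  private
    module C = Category 𝒞
    module D = Category 𝒟
    module F = Functor F
    module G = Functor G
  field
    component : ∀ A → D.Hom (F.F₀ A) (G.F₀ A)
    natural   : ∀ {A B} (f : C.Hom A B) →
                (component B D.⊙ F.F₁ f) D.≈ (G.F₁ f D.⊙ component A)

record _⊣_ {𝒞 : Category o m e} {𝒟 : Category o′ m′ e′}
           (L : Functor 𝒞 𝒟) (R : Functor 𝒟 𝒞) :
           Set (o ⊔ m ⊔ e ⊔ o′ ⊔ m′ ⊔ e′) where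
  private
    module C = Category 𝒞
    module D = Category 𝒟
    module L = Functor L
    module R = Functor R
  field
    unit   : Id 𝒞 ⇒ (R ∘F L)
    counit : (L ∘F R) ⇒ Id 𝒟
  module unit   = _⇒_ unit
  module counit = _⇒_ counit
  field
    zig : ∀ A → (counit.component (L.F₀ A) D.⊙ L.F₁ (unit.component A)) D.≈ D.idₘ (L.F₀ A)
    zag : ∀ B → (R.F₁ (counit.component B) C.⊙ unit.component (R.F₀ B)) C.≈ C.idₘ (R.F₀ B)

-- Disjointness of the sets of n-ary connectives is automatic: they are
-- the fibres of a family.
Signature : ∀ ℓ → Set (lsuc ℓ)
Signature ℓ = ℕ → Set ℓ

data Term (S : Signature ℓ) (V : Set) : Set ℓ where
  var : V → Term S V
  con : ∀ {n} → S n → Vec (Term S V) n → Term S V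

F : Signature ℓ → Set ℓ
F S = Term S ℕ

module _ {S : Signature ℓ} {V : Set} {A : Set ℓ}
         (g : V → A) (alg : ∀ {n} → S n → Vec A n → A) where

  fold  : Term S V → A
  fold* : ∀ {n} → Vec (Term S V) n → Vec A n
  fold (var x)    = g x
  fold (con c ts) = alg c (fold* ts)
  fold* []        = []
  fold* (t ∷ ts)  = fold t ∷ fold* ts

infixl 9 _[_]

_[_] : {S : Signature ℓ} {V W : Set} → Term S V → (V → Term S W) → Term S W
t [ σ ] = fold σ con t

data _OccursIn_ {S : Signature ℓ} {V : Set} (x : V) : Term S V → Set ℓ where
  here  : x OccursIn var x
  there : ∀ {n} {c : S n} {ts : Vec (Term S V) n} →
          VecAny.Any (x OccursIn_) ts → x OccursIn con c ts

-- Formulas whose variables are exactly x₀, …, xₙ₋₁: the variables of a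
-- term over Fin n are among these, and the second component says that each
-- of them does occur.
F[_] : ℕ → Signature ℓ → Set ℓ
F[ n ] S = Σ[ t ∈ Term S (Fin n) ] (∀ i → i OccursIn t)

FlexibleMorphism : Signature ℓ → Signature ℓ → Set ℓ
FlexibleMorphism S S′ = ∀ {n} → S n → F[ n ] S′

-- f̌, here on terms over any set of variables, so that it also applies to
-- τ(p) and Δ(p,q).
ext : {S S′ : Signature ℓ} {V : Set} → FlexibleMorphism S S′ → Term S V → Term S′ V
ext f = fold var (λ c ψs → proj₁ (f c) [ lookup ψs ])

image : {A B : Set ℓ} → (A → B) → Pred A ℓ → Pred B ℓ
image f Γ ψ = ∃[ γ ] (γ ∈ Γ × ψ ≡ f γ)

⌞_⌟ : {A : Set ℓ} → List A → Pred A ℓ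
⌞ xs ⌟ x = x ∈ˡ xs

record Logic (ℓ : Level) : Set (lsuc ℓ) where
  infix 4 _⊢_
  field
    sig        : Signature ℓ
    _⊢_        : Pred (F sig) ℓ → F sig → Set ℓ
    reflexive  : ∀ {Γ φ} → φ ∈ Γ → Γ ⊢ φ
    monotone   : ∀ {Γ Γ′ φ} → Γ ⊆ Γ′ → Γ ⊢ φ → Γ′ ⊢ φ
    cut        : ∀ {Γ Θ φ} → (∀ {θ} → θ ∈ Θ → Γ ⊢ θ) → Θ ⊢ φ → Γ ⊢ φ
    finitary   : ∀ {Γ φ} → Γ ⊢ φ → ∃[ Γ₀ ] (⌞ Γ₀ ⌟ ⊆ Γ × ⌞ Γ₀ ⌟ ⊢ φ)
    structural : ∀ {Γ φ} (σ : ℕ → F sig) → Γ ⊢ φ → image (_[ σ ]) Γ ⊢ φ [ σ ]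

-- The underlying set is a setoid, so that quotients can be formed; it may
-- be empty.
record Algebra (S : Signature ℓ) : Set (lsuc ℓ) where
  field
    carrier : Setoid ℓ ℓ
  open Setoid carrier public
    renaming (refl to ≈-refl; sym to ≈-sym; trans to ≈-trans; reflexive to ≈-reflexive)
  field
    op      : ∀ {n} → S n → Vec Carrier n → Carrier
    op-cong : ∀ {n} (c : S n) {xs ys : Vec Carrier n} →
              Pointwise _≈_ xs ys → op c xs ≈ op c ys

∣_∣ : {S : Signature ℓ} → Algebra S → Set ℓ
∣ M ∣ = Algebra.Carrier M

record AlgHom {S : Signature ℓ} (M N : Algebra S) : Set ℓ where
  private
    module M = Algebra M
    module N = Algebra N
  field
    fun      : ∣ M ∣ → ∣ N ∣
    fun-cong : ∀ {x y} → x M.≈ y → fun x N.≈ fun y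
    fun-op   : ∀ {n} (c : S n) (xs : Vec ∣ M ∣ n) →
               fun (M.op c xs) N.≈ N.op c (Vec.map fun xs)

open AlgHom public

module _ {S : Signature ℓ} {V : Set} (M : Algebra S) where
  open Algebra M

  eval : (V → ∣ M ∣) → Term S V → ∣ M ∣
  eval v = fold v op

  eval* : ∀ {n} → (V → ∣ M ∣) → Vec (Term S V) n → Vec ∣ M ∣ n
  eval* v = fold* v op

  eval-cong  : {v w : V → ∣ M ∣} → (∀ x → v x ≈ w x) → ∀ t → eval v t ≈ eval w t
  eval*-cong : {v w : V → ∣ M ∣} → (∀ x → v x ≈ w x) →
               ∀ {n} (ts : Vec (Term S V) n) → Pointwise _≈_ (eval* v ts) (eval* w ts)
  eval-cong p (var x)     = p x
  eval-cong p (con c ts)  = op-cong c (eval*-cong p ts)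
  eval*-cong p []         = []
  eval*-cong p (t ∷ ts)   = eval-cong p t ∷ eval*-cong p ts

  eval*-map : (v : V → ∣ M ∣) → ∀ {n} (ts : Vec (Term S V) n) →
              eval* v ts ≡ Vec.map (eval v) ts
  eval*-map v []       = refl
  eval*-map v (t ∷ ts) = cong (eval v t ∷_) (eval*-map v ts)

module _ {S : Signature ℓ} {V : Set} {M N : Algebra S} (f : AlgHom M N) where
  private
    module N = Algebra N

  hom-eval  : (v : V → ∣ M ∣) (t : Term S V) →
              fun f (eval M v t) N.≈ eval N (fun f ∘ v) t
  hom-eval* : (v : V → ∣ M ∣) → ∀ {n} (ts : Vec (Term S V) n) →
              Pointwise N._≈_ (Vec.map (fun f) (eval* M v ts)) (eval* N (fun f ∘ v) ts)
  hom-eval v (var x)    = N.≈-refl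
  hom-eval v (con c ts) = N.≈-trans (fun-op f c (eval* M v ts)) (N.op-cong c (hom-eval* v ts))
  hom-eval* v []        = []
  hom-eval* v (t ∷ ts)  = hom-eval v t ∷ hom-eval* v ts

module _ {S : Signature ℓ} {V W : Set} (M : Algebra S) (v : W → ∣ M ∣) (σ : V → Term S W) where
  open Algebra M

  eval-[]  : (t : Term S V) → eval M v (t [ σ ]) ≈ eval M (eval M v ∘ σ) t
  eval*-[] : ∀ {n} (ts : Vec (Term S V) n) →
             Pointwise _≈_ (eval* M v (fold* σ con ts)) (eval* M (eval M v ∘ σ) ts)
  eval-[] (var x)    = ≈-refl
  eval-[] (con c ts) = op-cong c (eval*-[] ts)
  eval*-[] []        = []
  eval*-[] (t ∷ ts)  = eval-[] t ∷ eval*-[] ts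

termAlgebra : (S : Signature ℓ) → Set → Algebra S
termAlgebra S V = record
  { carrier = setoid (Term S V)
  ; op      = con
  ; op-cong = λ c ps → cong (con c) (Pointwise-≡⇒≡ ps)
  }

[var]  : {S : Signature ℓ} {V : Set} (t : Term S V) → t [ var ] ≡ t
[var]* : {S : Signature ℓ} {V : Set} {n : ℕ} (ts : Vec (Term S V) n) → fold* var con ts ≡ ts
[var] (var x)    = refl
[var] (con c ts) = cong (con c) ([var]* ts)
[var]* []        = refl
[var]* (t ∷ ts)  = cong₂ _∷_ ([var] t) ([var]* ts)

-- f⋆(M), for all algebras M; the restriction to quasivarieties is h⋆↾ below.
reduct : {S S′ : Signature ℓ} → FlexibleMorphism S S′ → Algebra S′ → Algebra S
reduct f M = record
  { carrier = carrier
  ; op      = λ c xs → eval M (lookup xs) (proj₁ (f c))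
  ; op-cong = λ c ps → eval-cong M (PW.lookup ps) (proj₁ (f c))
  }
  where open Algebra M

reductHom : {S S′ : Signature ℓ} (f : FlexibleMorphism S S′) {M N : Algebra S′} →
            AlgHom M N → AlgHom (reduct f M) (reduct f N)
reductHom f {M} {N} k = record
  { fun      = fun k
  ; fun-cong = fun-cong k
  ; fun-op   = λ c xs → ≈-trans
      (hom-eval k (lookup xs) (proj₁ (f c)))
      (eval-cong N (λ i → ≈-reflexive (sym (lookup-map i (fun k) xs))) (proj₁ (f c)))
  }
  where open Algebra N

module _ {S S′ : Signature ℓ} {V : Set} (f : FlexibleMorphism S S′)
         (M : Algebra S′) (v : V → ∣ M ∣) where
  open Algebra M

  eval-ext  : (t : Term S V) → eval (reduct f M) v t ≈ eval M v (ext f t)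
  eval-ext* : ∀ {n} (ts : Vec (Term S V) n) (i : Fin n) →
              lookup (eval* (reduct f M) v ts) i ≈
              eval M v (lookup (fold* var (λ c ψs → proj₁ (f c) [ lookup ψs ]) ts) i)
  eval-ext (var x)           = ≈-refl
  eval-ext (con c ts)        = ≈-trans
    (eval-cong M (eval-ext* ts) (proj₁ (f c)))
    (≈-sym (eval-[] M v _ (proj₁ (f c))))
  eval-ext* (t ∷ ts) zero    = eval-ext t
  eval-ext* (t ∷ ts) (suc i) = eval-ext* ts i

ext-[] : {S S′ : Signature ℓ} {V W : Set} (f : FlexibleMorphism S S′)
         (σ : V → Term S W) (t : Term S V) → ext f (t [ σ ]) ≡ ext f t [ ext f ∘ σ ]
ext-[] {S′ = S′} {W = W} f σ t =
  trans (eval-[] (reduct f (termAlgebra S′ W)) var σ t)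
        (eval-ext f (termAlgebra S′ W) (ext f ∘ σ) t)

Eqn : Signature ℓ → Set → Set ℓ
Eqn S V = Term S V × Term S V

infix 6 _≐_

_≐_ : {S : Signature ℓ} {V : Set} → Term S V → Term S V → Eqn S V
s ≐ t = s , t

AlgClass : Signature ℓ → Set (lsuc (lsuc ℓ))
AlgClass {ℓ} S = Pred (Algebra S) (lsuc ℓ)

module _ {S : Signature ℓ} where

  infix 4 _,_⊨_ _⊨[_]_ _⊨[_]*_ _⊨q_

  _,_⊨_ : {V : Set} (M : Algebra S) → (V → ∣ M ∣) → Eqn S V → Set ℓ
  M , v ⊨ (s , t) = eval M v s ≈ eval M v t
    where open Algebra M

  _⊨[_]_ : Pred (Eqn S ℕ) ℓ → AlgClass S → Eqn S ℕ → Set (lsuc ℓ)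
  E ⊨[ K ] eq = ∀ M → M ∈ K → (v : ℕ → ∣ M ∣) →
                (∀ {eq′} → eq′ ∈ E → M , v ⊨ eq′) → M , v ⊨ eq

  _⊨[_]*_ : Pred (Eqn S ℕ) ℓ → AlgClass S → Pred (Eqn S ℕ) ℓ → Set (lsuc ℓ)
  E ⊨[ K ]* E′ = ∀ {eq} → eq ∈ E′ → E ⊨[ K ] eq

  QuasiEqn : Set ℓ
  QuasiEqn = List (Eqn S ℕ) × Eqn S ℕ

  _⊨q_ : Algebra S → QuasiEqn → Set ℓ
  M ⊨q (eqs , eq) = (v : ℕ → ∣ M ∣) → All (M , v ⊨_) eqs → M , v ⊨ eq

  Models : Pred QuasiEqn (lsuc ℓ) → AlgClass S
  Models Θ M = ∀ q → q ∈ Θ → M ⊨q q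

  IsQuasivariety : AlgClass S → Set (lsuc (lsuc ℓ))
  IsQuasivariety K = ∃[ Θ ] (∀ M → M ∈ K ⇔ M ∈ Models Θ)

  -- The quasivariety generated by K.
  Q : AlgClass S → AlgClass S
  Q K = Models (λ q → ∀ M → M ∈ K → M ⊨q q)

-- τ(p), where p is the only element of Fin 1.
Equations₁ : Signature ℓ → Set ℓ
Equations₁ S = List (Eqn S (Fin 1))

-- Δ(p,q), where p and q are the elements 0 and 1 of Fin 2.
Formulas₂ : Signature ℓ → Set ℓ
Formulas₂ S = List (Term S (Fin 2))

module _ {S : Signature ℓ} where

  pair : F S → F S → Fin 2 → F S
  pair φ ψ = lookup (φ ∷ ψ ∷ [])

  inst : F S → Eqn S (Fin 1) → Eqn S ℕ
  inst φ (ε , δ) = ε [ (λ _ → φ) ] , δ [ (λ _ → φ) ]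

  _⟨_⟩ : Equations₁ S → F S → List (Eqn S ℕ)
  τ ⟨ φ ⟩ = map (inst φ) τ

  _⟪_⟫ : Equations₁ S → Pred (F S) ℓ → Pred (Eqn S ℕ) ℓ
  (τ ⟪ Γ ⟫) eq = ∃[ γ ] (γ ∈ Γ × eq ∈ˡ τ ⟨ γ ⟩)

  _⦅_,_⦆ : Formulas₂ S → F S → F S → List (F S)
  Δ ⦅ φ , ψ ⦆ = map (_[ pair φ ψ ]) Δ

record AlgebraizedBy (a : Logic ℓ) (K : AlgClass (Logic.sig a))
                     (τ : Equations₁ (Logic.sig a)) (Δ : Formulas₂ (Logic.sig a)) :
                     Set (lsuc ℓ) where
  open Logic a
  field
    complete : ∀ Γ φ → Γ ⊢ φ ⇔ τ ⟪ Γ ⟫ ⊨[ K ]* ⌞ τ ⟨ φ ⟩ ⌟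
    inter→   : ∀ φ ψ → ｛ φ ≐ ψ ｝ ⊨[ K ]* τ ⟪ ⌞ Δ ⦅ φ , ψ ⦆ ⌟ ⟫
    inter←   : ∀ φ ψ → τ ⟪ ⌞ Δ ⦅ φ , ψ ⦆ ⌟ ⟫ ⊨[ K ] φ ≐ ψ

IsAlgebraizingPair : (a : Logic ℓ) → Equations₁ (Logic.sig a) → Formulas₂ (Logic.sig a) →
                     Set (lsuc (lsuc ℓ))
IsAlgebraizingPair a τ Δ = ∃[ K ] AlgebraizedBy a K τ Δ

record AlgebraizableLogic (ℓ : Level) : Set (lsuc (lsuc ℓ)) where
  field
    logic       : Logic ℓ
  open Logic logic public
  field
    K           : AlgClass sig
    τ           : Equations₁ sig
    Δ           : Formulas₂ sig
    algebraized : AlgebraizedBy logic K τ Δ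

module _ {a : Logic ℓ} where
  open Logic a

  Δ[_,_] : Formulas₂ sig → Pred (Eqn sig ℕ) ℓ → Pred (F sig) ℓ
  Δ[ Δ , E ] φ = ∃[ s ] ∃[ t ] ((s , t) ∈ E × φ ∈ˡ Δ ⦅ s , t ⦆)

  module AlgebraizedProperties {K : AlgClass sig} {τ : Equations₁ sig} {Δ : Formulas₂ sig}
                               (A : AlgebraizedBy a K τ Δ) where
    open AlgebraizedBy A

    ⊨⇒⊢ : ∀ {E s t} → E ⊨[ K ] (s , t) → ∀ {d} → d ∈ˡ Δ ⦅ s , t ⦆ → Δ[ Δ , E ] ⊢ d
    ⊨⇒⊢ {E} {s} {t} E⊨ {d} d∈ = Equivalence.from (complete _ _)
      λ {eq} eq∈ M M∈K v H → inter→ s t (d , d∈ , eq∈) M M∈K v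
        λ { refl → E⊨ M M∈K v (λ {(s′ , t′)} st∈ → inter← s′ t′ M M∈K v
          λ (ψ , ψ∈ , eq∈′) → H (ψ , (s′ , t′ , st∈ , ψ∈) , eq∈′)) }

    ⊢⇒⊨ : ∀ {E s t} → (∀ {d} → d ∈ˡ Δ ⦅ s , t ⦆ → Δ[ Δ , E ] ⊢ d) → E ⊨[ K ] (s , t)
    ⊢⇒⊨ {E} {s} {t} ⊢d M M∈K v H = inter← s t M M∈K v
      λ (d , d∈ , eq∈) → Equivalence.to (complete _ _) (⊢d d∈) eq∈ M M∈K v
        λ (ψ , (s′ , t′ , st∈ , ψ∈) , eq∈′) →
          inter→ s′ t′ (ψ , ψ∈ , eq∈′) M M∈K v λ { refl → H st∈ }

    ∅⊨⇒∅⊢ : ∀ {s t} → ∅ ⊨[ K ] (s , t) → ∀ {d} → d ∈ˡ Δ ⦅ s , t ⦆ → ∅ ⊢ d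
    ∅⊨⇒∅⊢ p d∈ = monotone (λ ()) (⊨⇒⊢ p d∈)

    ∅⊢⇒∅⊨ : ∀ {s t} → (∀ {d} → d ∈ˡ Δ ⦅ s , t ⦆ → ∅ ⊢ d) → ∅ ⊨[ K ] (s , t)
    ∅⊢⇒∅⊨ p = ⊢⇒⊨ (λ d∈ → monotone (λ ()) (p d∈))

    private
      finite : ∀ eqs eq → ⌞ eqs ⌟ ⊨[ K ] eq → ⌞ eqs ⌟ ⊨[ Q K ] eq
      finite eqs eq p M M∈Q v H =
        M∈Q (eqs , eq) (λ N N∈K w H′ → p N N∈K w (All.lookup H′)) v (All.tabulate H)

      τ-list⁺ : ∀ Γ₀ {eq} → eq ∈ τ ⟪ ⌞ Γ₀ ⌟ ⟫ → eq ∈ˡ concatMap (τ ⟨_⟩) Γ₀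
      τ-list⁺ Γ₀ (γ , γ∈ , eq∈) = ∈-concatMap⁺ (τ ⟨_⟩) (Any.map (λ { refl → eq∈ }) γ∈)

      τ-list⁻ : ∀ Γ₀ {eq} → eq ∈ˡ concatMap (τ ⟨_⟩) Γ₀ → eq ∈ τ ⟪ ⌞ Γ₀ ⌟ ⟫
      τ-list⁻ Γ₀ eq∈ = find (∈-concatMap⁻ (τ ⟨_⟩) {xs = Γ₀} eq∈)

      τ-finite : ∀ Γ₀ eq → τ ⟪ ⌞ Γ₀ ⌟ ⟫ ⊨[ K ] eq → τ ⟪ ⌞ Γ₀ ⌟ ⟫ ⊨[ Q K ] eq
      τ-finite Γ₀ eq p M M∈Q v H = finite (concatMap (τ ⟨_⟩) Γ₀) eq
        (λ N N∈K w H′ → p N N∈K w λ {eq′} eq∈ → H′ {eq′} (τ-list⁺ Γ₀ eq∈))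
        M M∈Q v
        (λ {eq′} eq∈ → H {eq′} (τ-list⁻ Γ₀ eq∈))

    Q-algebraized : AlgebraizedBy a (Q K) τ Δ
    Q-algebraized = record
      { complete = λ Γ φ → mk⇔
          (λ Γ⊢φ {eq} eq∈ M M∈Q v H →
            let (Γ₀ , Γ₀⊆Γ , Γ₀⊢φ) = finitary Γ⊢φ in
            τ-finite Γ₀ eq (Equivalence.to (complete _ _) Γ₀⊢φ eq∈) M M∈Q v
              λ {eq′} (γ , γ∈ , eq∈′) → H {eq′} (γ , Γ₀⊆Γ γ∈ , eq∈′))
          (λ p → Equivalence.from (complete Γ φ) λ eq∈ M M∈K →
            p eq∈ M (λ q valid → valid M M∈K))
      ; inter→ = λ φ ψ {eq} eq∈ M M∈Q v H →
          finite (φ ≐ ψ ∷ []) eq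
            (λ N N∈K w H′ → inter→ φ ψ eq∈ N N∈K w λ { refl → H′ (here refl) })
            M M∈Q v (λ { (here refl) → H refl })
      ; inter← = λ φ ψ → τ-finite (Δ ⦅ φ , ψ ⦆) (φ ≐ ψ) (inter← φ ψ)
      }

  module _ {K K′ : AlgClass sig} {τ τ′ : Equations₁ sig} {Δ Δ′ : Formulas₂ sig}
           (A : AlgebraizedBy a K τ Δ) (A′ : AlgebraizedBy a K′ τ′ Δ′) where
    private
      module A  = AlgebraizedBy A
      module A′ = AlgebraizedBy A′

    Δ⊢Δ′ : ∀ s t {d} → d ∈ˡ Δ′ ⦅ s , t ⦆ → ⌞ Δ ⦅ s , t ⦆ ⌟ ⊢ d
    Δ⊢Δ′ s t d∈ with ∈-map⁻ (_[ pair s t ]) d∈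
    ... | D , D∈ , refl = Equivalence.from (A.complete _ _) step
      where
      ⊢Dss : ∅ ⊢ D [ pair s s ]
      ⊢Dss = Equivalence.from (A′.complete _ _) λ eq∈ M M∈K v H →
        A′.inter→ s s (D [ pair s s ] , ∈-map⁺ (_[ pair s s ]) D∈ , eq∈) M M∈K v
          λ { refl → Algebra.≈-refl M }
      step : τ ⟪ ⌞ Δ ⦅ s , t ⦆ ⌟ ⟫ ⊨[ K ]* ⌞ τ ⟨ D [ pair s t ] ⟩ ⌟
      step eq∈ M M∈K v H with ∈-map⁻ (inst (D [ pair s t ])) eq∈
      ... | (ε , δ) , εδ∈ , refl =
        ≈-trans (≈-sym (change ε)) (≈-trans
          (Equivalence.to (A.complete _ _) ⊢Dss (∈-map⁺ (inst (D [ pair s s ])) εδ∈) M M∈K v (λ ()))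
          (change δ))
        where
        open Algebra M
        pw : ∀ i → eval M v (pair s s i) ≈ eval M v (pair s t i)
        pw zero       = ≈-refl
        pw (suc zero) = A.inter← s t M M∈K v H
        D≈ : eval M v (D [ pair s s ]) ≈ eval M v (D [ pair s t ])
        D≈ = ≈-trans (eval-[] M v (pair s s) D)
               (≈-trans (eval-cong M pw D) (≈-sym (eval-[] M v (pair s t) D)))
        change : ∀ (χ : Term sig (Fin 1)) → eval M v (χ [ (λ _ → D [ pair s s ]) ]) ≈
                                            eval M v (χ [ (λ _ → D [ pair s t ]) ])
        change χ = ≈-trans (eval-[] M v _ χ)
                     (≈-trans (eval-cong M (λ _ → D≈) χ) (≈-sym (eval-[] M v _ χ)))

  ⊨-transfer : ∀ {K K′ τ τ′ Δ Δ′} → AlgebraizedBy a K τ Δ → AlgebraizedBy a K′ τ′ Δ′ →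
               ∀ E eq → E ⊨[ K ] eq → E ⊨[ K′ ] eq
  ⊨-transfer A A′ E (s , t) p = AlgebraizedProperties.⊢⇒⊨ A′
    λ d∈ → cut (λ (s′ , t′ , st∈ , θ∈) →
                  monotone (λ ψ∈ → s′ , t′ , st∈ , ψ∈) (Δ⊢Δ′ A′ A s′ t′ θ∈))
               (cut (AlgebraizedProperties.⊨⇒⊢ A p) (Δ⊢Δ′ A A′ s t d∈))

  Q-unique : ∀ {K K′ τ τ′ Δ Δ′} → AlgebraizedBy a K τ Δ → AlgebraizedBy a K′ τ′ Δ′ →
             ∀ M → M ∈ Q K → M ∈ Q K′
  Q-unique A A′ M M∈Q (eqs , eq) valid = M∈Q (eqs , eq) λ N N∈K v H →
    ⊨-transfer A′ A ⌞ eqs ⌟ eq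
      (λ M M∈K′ w H′ → valid M M∈K′ w (All.tabulate H′)) N N∈K v (All.lookup H)

module _ (a : AlgebraizableLogic ℓ) where
  open AlgebraizableLogic a

  -- The three facts that follow say that this is the quasivariety that can
  -- serve as K; in particular it does not depend on the K, τ, Δ stored in a.
  QV : AlgClass sig
  QV = Q K

  QV-isQuasivariety : IsQuasivariety QV
  QV-isQuasivariety = _ , λ M → mk⇔ id id

  QV-algebraized : AlgebraizedBy logic QV τ Δ
  QV-algebraized = AlgebraizedProperties.Q-algebraized algebraized

  QV-unique : ∀ {K′ τ′ Δ′} → IsQuasivariety K′ → AlgebraizedBy logic K′ τ′ Δ′ →
              ∀ M → M ∈ K′ ⇔ M ∈ QV
  QV-unique (Θ , K′⇔Θ) A′ M = mk⇔
    (λ M∈K′ → Q-unique A′ algebraized M λ q valid → valid M M∈K′)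
    (λ M∈QV → Equivalence.from (K′⇔Θ M) λ q q∈Θ →
      Q-unique algebraized A′ M M∈QV q λ N N∈K′ → Equivalence.to (K′⇔Θ N) N∈K′ q q∈Θ)

  QVAlg : Set (lsuc ℓ)
  QVAlg = Σ (Algebra sig) QV

  𝒬𝒱 : Category (lsuc ℓ) ℓ ℓ
  𝒬𝒱 = record
    { Obj       = QVAlg
    ; Hom       = λ (M , _) (N , _) → AlgHom M N
    ; _≈_       = λ {_} {(N , _)} f g → ∀ x → Algebra._≈_ N (fun f x) (fun g x)
    ; idₘ       = λ (M , _) → record
        { fun      = id
        ; fun-cong = id
        ; fun-op   = λ c xs → Algebra.≈-reflexive M (cong (Algebra.op M c) (sym (map-id xs)))
        }
    ; _⊙_       = λ {_} {_} {(P , _)} f g → record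
        { fun      = fun f ∘ fun g
        ; fun-cong = fun-cong f ∘ fun-cong g
        ; fun-op   = λ c xs → Algebra.≈-trans P
            (Algebra.≈-trans P (fun-cong f (fun-op g c xs)) (fun-op f c _))
            (Algebra.≈-reflexive P (cong (Algebra.op P c) (sym (map-∘ (fun f) (fun g) xs))))
        }
    ; equiv     = λ {_} {(N , _)} → record
        { refl  = λ x → Algebra.≈-refl N
        ; sym   = λ p x → Algebra.≈-sym N (p x)
        ; trans = λ p q x → Algebra.≈-trans N (p x) (q x)
        }
    ; ⊙-resp-≈  = λ {_} {_} {(P , _)} {f} {_} {_} {g′} p q x →
        Algebra.≈-trans P (fun-cong f (q x)) (p (fun g′ x))
    ; identityˡ = λ {_} {(N , _)} f x → Algebra.≈-refl N
    ; identityʳ = λ {_} {(N , _)} f x → Algebra.≈-refl N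
    ; assoc     = λ {_} {_} {_} {(P , _)} f g h x → Algebra.≈-refl P
    }

  private
    module P = AlgebraizedProperties algebraized

    _~_ : F sig → F sig → Set ℓ
    φ ~ ψ = ∀ {d} → d ∈ˡ Δ ⦅ φ , ψ ⦆ → ∅ ⊢ d

    _≈K_ : F sig → F sig → Set (lsuc ℓ)
    φ ≈K ψ = ∀ M → M ∈ K → (v : ℕ → ∣ M ∣) → M , v ⊨ φ ≐ ψ

    ~⇒≈K : ∀ {φ ψ} → φ ~ ψ → φ ≈K ψ
    ~⇒≈K p M M∈K v = P.∅⊢⇒∅⊨ p M M∈K v (λ ())

    ≈K⇒~ : ∀ {φ ψ} → φ ≈K ψ → φ ~ ψ
    ≈K⇒~ p = P.∅⊨⇒∅⊢ (λ M M∈K v _ → p M M∈K v)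

  -- F(Σ)/Δ: quotients are setoids, so [φ] is φ itself, taken up to ⊢ φ Δ ψ.
  F/Δ : Algebra sig
  F/Δ = record
    { carrier = record
        { Carrier       = F sig
        ; _≈_           = λ φ ψ → ∀ {d} → d ∈ˡ Δ ⦅ φ , ψ ⦆ → ∅ ⊢ d
        ; isEquivalence = record
            { refl  = ≈K⇒~ λ M M∈K v → Algebra.≈-refl M
            ; sym   = λ p → ≈K⇒~ λ M M∈K v → Algebra.≈-sym M (~⇒≈K p M M∈K v)
            ; trans = λ p q → ≈K⇒~ λ M M∈K v →
                Algebra.≈-trans M (~⇒≈K p M M∈K v) (~⇒≈K q M M∈K v)
            }
        }
    ; op      = con
    ; op-cong = λ c ps → ≈K⇒~ λ M M∈K v → Algebra.op-cong M c (args M M∈K v ps)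
    }
    where
    args : ∀ M → M ∈ K → (v : ℕ → ∣ M ∣) → ∀ {n} {φs ψs : Vec (F sig) n} →
           Pointwise _~_ φs ψs → Pointwise (Algebra._≈_ M) (eval* M v φs) (eval* M v ψs)
    args M M∈K v []       = []
    args M M∈K v (p ∷ ps) = ~⇒≈K p M M∈K v ∷ args M M∈K v ps

  F/Δ∈QV : F/Δ ∈ QV
  F/Δ∈QV (eqs , (s , t)) valid v H = ≈K⇒~ λ M M∈K w →
    let open Algebra M in
    ≈-trans (eval-[] M w v s) (≈-trans
      (valid M M∈K (eval M w ∘ v) (All.map
        (λ {(s′ , t′)} p → ≈-trans (≈-sym (eval-[] M w v s′))
          (≈-trans (~⇒≈K p M M∈K w) (eval-[] M w v t′))) H))
      (≈-sym (eval-[] M w v t)))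

  F/Δᵒ : QVAlg
  F/Δᵒ = F/Δ , F/Δ∈QV

  -- F(Σ)/Δ is free over X on the classes of the variables.
  free : ((N , _) : QVAlg) → (ℕ → ∣ N ∣) → AlgHom F/Δ N
  free (N , N∈QV) v = record
    { fun      = eval N v
    ; fun-cong = λ {φ} {ψ} p → N∈QV ([] , φ ≐ ψ) (λ M M∈K w _ → ~⇒≈K p M M∈K w) v All.[]
    ; fun-op   = λ c φs → Algebra.≈-reflexive N (cong (Algebra.op N c) (eval*-map N v φs))
    }

  free-unique : ((N , _) : QVAlg) (f : AlgHom F/Δ N) → ∀ φ →
                Algebra._≈_ N (fun f φ) (eval N (fun f ∘ var) φ)
  free-unique (N , _) f φ = Algebra.≈-trans N
    (Algebra.≈-reflexive N (cong (fun f) (sym ([var] φ))))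
    (hom-eval f var φ)

-- The morphisms of 𝒜_f.
record _⟶_ (a a′ : AlgebraizableLogic ℓ) : Set (lsuc (lsuc ℓ)) where
  private
    module a  = AlgebraizableLogic a
    module a′ = AlgebraizableLogic a′
  field
    morphism  : FlexibleMorphism a.sig a′.sig
    translate : ∀ {Γ ψ} → Γ a.⊢ ψ → image (ext morphism) Γ a′.⊢ ext morphism ψ
    preserve  : ∀ τ Δ → IsAlgebraizingPair a.logic τ Δ →
                IsAlgebraizingPair a′.logic
                  (map (λ (ε , δ) → ext morphism ε , ext morphism δ) τ)
                  (map (ext morphism) Δ)

module _ {a a′ : AlgebraizableLogic ℓ} (h : a ⟶ a′) where
  private
    module a  = AlgebraizableLogic a
    module a′ = AlgebraizableLogic a′
  open _⟶_ h

  ȟ : F a.sig → F a′.sig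
  ȟ = ext morphism

  private
    ȟΔ : Formulas₂ a′.sig
    ȟΔ = map (ext morphism) a.Δ

    ȟₑ : Eqn a.sig ℕ → Eqn a′.sig ℕ
    ȟₑ (s , t) = ȟ s , ȟ t

    ȟ-pair : ∀ s t D → ȟ (D [ pair s t ]) ≡ ext morphism D [ pair (ȟ s) (ȟ t) ]
    ȟ-pair s t D = trans (ext-[] morphism (pair s t) D)
      (eval-cong (termAlgebra a′.sig ℕ) (λ { zero → refl ; (suc zero) → refl }) (ext morphism D))

    ∈ȟΔ : ∀ {s t d} → d ∈ˡ a.Δ ⦅ s , t ⦆ → ȟ d ∈ˡ ȟΔ ⦅ ȟ s , ȟ t ⦆
    ∈ȟΔ {s} {t} d∈ with ∈-map⁻ (_[ pair s t ]) d∈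
    ... | D , D∈ , refl = subst (_∈ˡ ȟΔ ⦅ ȟ s , ȟ t ⦆) (sym (ȟ-pair s t D))
                            (∈-map⁺ _ (∈-map⁺ (ext morphism) D∈))

    ∈ȟΔ⁻ : ∀ {s t d} → d ∈ˡ ȟΔ ⦅ ȟ s , ȟ t ⦆ → ∃[ d₀ ] (d₀ ∈ˡ a.Δ ⦅ s , t ⦆ × d ≡ ȟ d₀)
    ∈ȟΔ⁻ {s} {t} d∈ with ∈-map⁻ (_[ pair (ȟ s) (ȟ t) ]) d∈
    ... | D′ , D′∈ , refl with ∈-map⁻ (ext morphism) D′∈
    ... | D , D∈ , refl = D [ pair s t ] , ∈-map⁺ _ D∈ , sym (ȟ-pair s t D)

  reduct-QV : ∀ M → M ∈ QV a′ → reduct morphism M ∈ QV a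
  reduct-QV M M∈QV (eqs , (s , t)) valid v H =
    ≈-trans (eval-ext morphism M v s) (≈-trans
      (M∈QV (map ȟₑ eqs , (ȟ s , ȟ t)) valid′ v
        (map⁺ (All.map (λ {(s′ , t′)} p → ≈-trans (≈-sym (eval-ext morphism M v s′))
          (≈-trans p (eval-ext morphism M v t′))) H)))
      (≈-sym (eval-ext morphism M v t)))
    where
    open Algebra M
    pair′ : IsAlgebraizingPair a′.logic _ _
    pair′ = preserve a.τ a.Δ (a.K , a.algebraized)
    ⊢d : ∀ {d} → d ∈ˡ a.Δ ⦅ s , t ⦆ → Δ[_,_] {a = a.logic} a.Δ ⌞ eqs ⌟ a.⊢ d
    ⊢d = AlgebraizedProperties.⊨⇒⊢ a.algebraized
      (λ N N∈K w H′ → valid N N∈K w (All.tabulate H′))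
    ⊢d′ : ∀ {d} → d ∈ˡ ȟΔ ⦅ ȟ s , ȟ t ⦆ → Δ[_,_] {a = a′.logic} ȟΔ ⌞ map ȟₑ eqs ⌟ a′.⊢ d
    ⊢d′ d∈ with ∈ȟΔ⁻ {s} {t} d∈
    ... | d₀ , d₀∈ , refl = a′.monotone
      (λ { (γ , (s′ , t′ , st∈ , γ∈) , refl) → ȟ s′ , ȟ t′ , ∈-map⁺ ȟₑ st∈ , ∈ȟΔ γ∈ })
      (translate (⊢d d₀∈))
    valid′ : ∀ N → N ∈ a′.K → N ⊨q (map ȟₑ eqs , (ȟ s , ȟ t))
    valid′ N N∈K w H′ = ⊨-transfer (proj₂ pair′) a′.algebraized ⌞ map ȟₑ eqs ⌟ (ȟ s ≐ ȟ t)
      (AlgebraizedProperties.⊢⇒⊨ (proj₂ pair′) ⊢d′) N N∈K w (All.lookup H′)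

  h⋆↾ : Functor (𝒬𝒱 a′) (𝒬𝒱 a)
  h⋆↾ = record
    { F₀       = λ (M , M∈QV) → reduct morphism M , reduct-QV M M∈QV
    ; F₁       = reductHom morphism
    ; F-resp-≈ = id
    ; F-id     = λ (M , _) x → Algebra.≈-refl M
    ; F-⊙      = λ {_} {_} {(P , _)} f g x → Algebra.≈-refl P
    }

  ∂̄X : AlgHom (F/Δ a) (reduct morphism (F/Δ a′))
  ∂̄X = free a (Functor.F₀ h⋆↾ (F/Δᵒ a′)) var

  ∂̄X-class : ∀ θ → fun ∂̄X θ ≡ ȟ θ
  ∂̄X-class θ = refl

  -- The identification of L_h(F(Σ)/Δ) with F(Σ′)/Δ′, for any left adjoint
  -- of h⋆↾: an isomorphism carrying ∂̄X to the unit (and determined by this,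
  -- the algebra F(Σ′)/Δ′ being free on the classes of the variables).
  module Identification (L : Functor (𝒬𝒱 a) (𝒬𝒱 a′)) (L⊣h⋆ : L ⊣ h⋆↾) where
    private
      module L  = Functor L
      module L⊣ = _⊣_ L⊣h⋆
      LF : QVAlg a′
      LF = L.F₀ (F/Δᵒ a)
      module LF = Algebra (proj₁ LF)
      module F′ = Algebra (F/Δ a′)
      module C  = Category (𝒬𝒱 a)
      module D  = Category (𝒬𝒱 a′)
      module H  = Functor h⋆↾
      hF′ hLF : QVAlg a
      hF′ = H.F₀ (F/Δᵒ a′)
      hLF = H.F₀ LF
      module LhF′ = Algebra (proj₁ (L.F₀ hF′))
      module LhLF = Algebra (proj₁ (L.F₀ hLF))
      unitF : AlgHom (F/Δ a) (reduct morphism (proj₁ LF))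
      unitF = L⊣.unit.component (F/Δᵒ a)

    identify : AlgHom (F/Δ a′) (proj₁ LF)
    identify = free a′ LF (λ n → fun unitF (var n))

    identify-∂̄X : ∀ θ → fun identify (fun ∂̄X θ) LF.≈ fun unitF θ
    identify-∂̄X θ = LF.≈-sym (LF.≈-trans
      (free-unique a hLF unitF θ)
      (eval-ext morphism (proj₁ LF) _ θ))

    identify⁻¹ : AlgHom (proj₁ LF) (F/Δ a′)
    identify⁻¹ = D._⊙_ {LF} {L.F₀ hF′} {F/Δᵒ a′}
      (L⊣.counit.component (F/Δᵒ a′)) (L.F₁ {F/Δᵒ a} {hF′} ∂̄X)

    identify⁻¹-unit : ∀ θ → fun identify⁻¹ (fun unitF θ) F′.≈ ȟ θ
    identify⁻¹-unit θ = F′.≈-trans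
      (fun-cong (L⊣.counit.component (F/Δᵒ a′))
        (LhF′.≈-sym (L⊣.unit.natural {F/Δᵒ a} {hF′} ∂̄X θ)))
      (L⊣.zag (F/Δᵒ a′) (ȟ θ))

    identify⁻¹∘identify : ∀ θ′ → fun identify⁻¹ (fun identify θ′) F′.≈ θ′
    identify⁻¹∘identify θ′ = F′.≈-trans
      (hom-eval identify⁻¹ (λ n → fun unitF (var n)) θ′) (F′.≈-trans
      (eval-cong (F/Δ a′) (λ n → identify⁻¹-unit (var n)) θ′)
      (F′.≈-reflexive ([var] θ′)))

    identify∘identify⁻¹ : ∀ x → fun identify (fun identify⁻¹ x) LF.≈ x
    identify∘identify⁻¹ x = LF.≈-trans
      (fun-cong g (LF.≈-sym (L⊣.zig A x))) (LF.≈-trans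
      (LF.≈-sym (L⊣.counit.natural {LF} {LF} g (fun (L.F₁ {A} {hLF} unitF) x))) (LF.≈-trans
      (fun-cong (L⊣.counit.component LF)
        (LhLF.≈-trans
          (LhLF.≈-sym (L.F-⊙ {A} {hLF} {hLF} (H.F₁ {LF} {LF} g) unitF x))
          (L.F-resp-≈ {A} {hLF} {C._⊙_ {A} {hLF} {hLF} (H.F₁ {LF} {LF} g) unitF} {unitF}
            (λ θ → LF.≈-trans (fun-cong identify (identify⁻¹-unit θ)) (identify-∂̄X θ)) x)))
      (L⊣.zig A x)))
      where
      A : QVAlg a
      A = F/Δᵒ a
      g : AlgHom (proj₁ LF) (proj₁ LF)
      g = D._⊙_ {LF} {F/Δᵒ a′} {LF} identify identify⁻¹

-- A left adjoint is unique only up to isomorphism, so L_h is any left adjoint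
-- of h⋆↾, and its unit is ∂̄.
record GlivenkoContext (a a′ : AlgebraizableLogic ℓ) : Set (lsuc (lsuc ℓ)) where
  field
    h       : a ⟶ a′
    L       : Functor (𝒬𝒱 a) (𝒬𝒱 a′)
    L⊣h⋆    : L ⊣ h⋆↾ h
    ρ̄       : (h⋆↾ h ∘F L) ⇒ Id (𝒬𝒱 a)
  private
    module h⋆ = Functor (h⋆↾ h)
    module L  = Functor L
    module ∂̄  = _⇒_ (_⊣_.unit L⊣h⋆)
    module ρ̄  = _⇒_ ρ̄
    open Category (𝒬𝒱 a)
  field
    section : ∀ M → let h⋆LM = h⋆.F₀ (L.F₀ M) in
              _≈_ {h⋆LM} {h⋆LM}
                (_⊙_ {h⋆LM} {M} {h⋆LM} (∂̄.component M) (ρ̄.component M))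
                (idₘ h⋆LM)

  -- The component of ρ̄ at F(Σ)/Δ has domain h⋆(L_h(F(Σ)/Δ)); it is
  -- read along the identification.
  ρ̄X : AlgHom (reduct (_⟶_.morphism h) (F/Δ a′)) (F/Δ a)
  ρ̄X = _⊙_ {h⋆.F₀ (F/Δᵒ a′)} {h⋆.F₀ (L.F₀ (F/Δᵒ a))} {F/Δᵒ a}
         (ρ̄.component (F/Δᵒ a)) (h⋆.F₁ {F/Δᵒ a′} {L.F₀ (F/Δᵒ a)} identify)
    where open Identification h L L⊣h⋆

  IsLifting : (F (AlgebraizableLogic.sig a′) → F (AlgebraizableLogic.sig a)) → Set ℓ
  IsLifting ρX = ∀ θ′ → Algebra._≈_ (F/Δ a) (ρX θ′) (fun ρ̄X θ′)

{-# OPTIONS --safe #-}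

-- By algebraizability, Γ ⊢ φ means that in every algebra of QV(a), under every
-- valuation, φ takes a value solving τ as soon as all members of Γ do; and for
-- ⊢′ one may use ȟ(τ), whose solutions in N are the solutions of τ in h⋆(N).
-- Solutions are preserved by homomorphisms.
-- (⇒) A valuation in N is one in h⋆(N), where ρX(θ′) and θ′ have the same
--     value, because ρ̄X is a section of ∂̄X.
-- (⇐) A valuation v in M extends to F(Σ)/Δ → M, to which L_h assigns a map
--     w : F(Σ′)/Δ′ → L_h(M). By naturality of ρ̄, the value of ρX(θ′) under v is
--     ρ̄_M(w(θ′)), and since ρ̄_M is a section of ∂̄_M, it solves τ in M if and
--     only if w(θ′) solves it in h⋆(L_h(M)).
module Submission where

open import Defs
open import Level using (Level)
open import Data.List.Base using (map)
open import Data.List.Membership.Propositional using () renaming (_∈_ to _∈ˡ_)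
open import Data.List.Membership.Propositional.Properties using (∈-map⁺; ∈-map⁻)
open import Data.Nat.Base using (ℕ)
open import Data.Product.Base using (_,_; proj₁; proj₂)
open import Function.Base using (_∘_)
open import Function.Bundles using (_⇔_; mk⇔; Equivalence)
open import Relation.Binary.PropositionalEquality using (refl)
open import Relation.Unary using (Pred; _∈_)

open AlgebraizableLogic using (sig; logic; τ; Δ)

private
  variable
    ℓ : Level

-- A condition on elements rather than on formulas, so that it can be carried along homomorphisms.
Solves : {S : Signature ℓ} (M : Algebra S) → Equations₁ S → ∣ M ∣ → Set ℓ
Solves M τ x = ∀ e → e ∈ˡ τ → M , (λ _ → x) ⊨ e

module _ {S : Signature ℓ} {τ : Equations₁ S} where

  Solves-resp-≈ : (M : Algebra S) → let open Algebra M in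
                  ∀ {x y} → x ≈ y → Solves M τ x → Solves M τ y
  Solves-resp-≈ M x≈y sol (ε , δ) e∈ =
    ≈-trans (≈-sym (eval-cong M (λ _ → x≈y) ε))
      (≈-trans (sol _ e∈) (eval-cong M (λ _ → x≈y) δ))
    where open Algebra M

  Solves-hom : {M N : Algebra S} (f : AlgHom M N) →
               ∀ {x} → Solves M τ x → Solves N τ (fun f x)
  Solves-hom {N = N} f sol (ε , δ) e∈ =
    ≈-trans (≈-sym (hom-eval f _ ε)) (≈-trans (fun-cong f (sol _ e∈)) (hom-eval f _ δ))
    where open Algebra N

  Solves-eval : (M : Algebra S) (v : ℕ → ∣ M ∣) (φ : F S) →
                (∀ {eq} → eq ∈ˡ τ ⟨ φ ⟩ → M , v ⊨ eq) ⇔ Solves M τ (eval M v φ)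
  Solves-eval M v φ = mk⇔
    (λ ⊨τφ (ε , δ) e∈ → ≈-trans (≈-sym (eval-[] M v _ ε))
      (≈-trans (⊨τφ (∈-map⁺ (inst φ) e∈)) (eval-[] M v _ δ)))
    from
    where
    open Algebra M
    from : Solves M τ (eval M v φ) → ∀ {eq} → eq ∈ˡ τ ⟨ φ ⟩ → M , v ⊨ eq
    from sol eq∈ with ∈-map⁻ (inst φ) eq∈
    ... | (ε , δ) , e∈ , refl =
      ≈-trans (eval-[] M v _ ε) (≈-trans (sol _ e∈) (≈-sym (eval-[] M v _ δ)))

extEqs : {S S′ : Signature ℓ} → FlexibleMorphism S S′ → Equations₁ S → Equations₁ S′
extEqs f = map (λ (ε , δ) → ext f ε , ext f δ)

Solves-reduct : {S S′ : Signature ℓ} (f : FlexibleMorphism S S′) {τ : Equations₁ S}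
                (N : Algebra S′) {x : ∣ N ∣} →
                Solves (reduct f N) τ x ⇔ Solves N (extEqs f τ) x
Solves-reduct f {τ} N {x} = mk⇔ to
  (λ sol (ε , δ) e∈ → ≈-trans (eval-ext f N _ ε)
    (≈-trans (sol _ (∈-map⁺ _ e∈)) (≈-sym (eval-ext f N _ δ))))
  where
  open Algebra N
  to : Solves (reduct f N) τ x → Solves N (extEqs f τ) x
  to sol _ e∈ with ∈-map⁻ _ e∈
  ... | (ε , δ) , e∈τ , refl =
    ≈-trans (≈-sym (eval-ext f N _ ε)) (≈-trans (sol _ e∈τ) (eval-ext f N _ δ))

⊢⇔Solves : {a : Logic ℓ} {K : AlgClass (Logic.sig a)} {τ : Equations₁ (Logic.sig a)}
           {Δ : Formulas₂ (Logic.sig a)} → AlgebraizedBy a K τ Δ →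
           ∀ Γ φ → Logic._⊢_ a Γ φ ⇔
             (∀ M → M ∈ K → (v : ℕ → ∣ M ∣) →
               (∀ {γ} → γ ∈ Γ → Solves M τ (eval M v γ)) → Solves M τ (eval M v φ))
⊢⇔Solves A Γ φ = mk⇔
  (λ Γ⊢φ M M∈K v H → Equivalence.to (Solves-eval M v φ) λ eq∈ →
    Equivalence.to (complete Γ φ) Γ⊢φ eq∈ M M∈K v
      λ (γ , γ∈ , eq∈′) → Equivalence.from (Solves-eval M v γ) (H γ∈) eq∈′)
  (λ p → Equivalence.from (complete Γ φ) λ eq∈ M M∈K v H →
    Equivalence.from (Solves-eval M v φ)
      (p M M∈K v λ {γ} γ∈ → Equivalence.to (Solves-eval M v γ)
        λ eq∈′ → H (γ , γ∈ , eq∈′))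
      eq∈)
  where open AlgebraizedBy A

-- Any algebraizing pair serves, because all of them share the quasivariety QV(a).
⊢⇔QV-Solves : (a : AlgebraizableLogic ℓ) {τ : Equations₁ (sig a)} {Δ : Formulas₂ (sig a)} →
              IsAlgebraizingPair (logic a) τ Δ →
              ∀ Γ φ → AlgebraizableLogic._⊢_ a Γ φ ⇔
                (((M , _) : QVAlg a) (v : ℕ → ∣ M ∣) →
                  (∀ {γ} → γ ∈ Γ → Solves M τ (eval M v γ)) → Solves M τ (eval M v φ))
⊢⇔QV-Solves a (K , A) Γ φ = mk⇔
  (λ Γ⊢φ (M , M∈QV) → Equivalence.to char Γ⊢φ M (Q-unique algebraized A M M∈QV))
  (λ p → Equivalence.from char λ M M∈QK → p (M , Q-unique A algebraized M M∈QK))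
  where
  open AlgebraizableLogic a using (algebraized)
  char = ⊢⇔Solves (AlgebraizedProperties.Q-algebraized A) Γ φ

module _ {a a′ : AlgebraizableLogic ℓ} (G : GlivenkoContext a a′) where
  open GlivenkoContext G
  open _⟶_ h
  open Identification h L L⊣h⋆
  private
    module h⋆ = Functor (h⋆↾ h)
    module L  = Functor L
    module ρ̄  = _⇒_ ρ̄
    module ∂̄  = _⇒_ (_⊣_.unit L⊣h⋆)

  -- `section` speaks of the unit at F(Σ)/Δ, which `identify` turns into `∂̄X`. The equation thus
  -- holds after applying `identify`, and `identify⁻¹` cancels it.
  ∂̄X∘ρ̄X : ∀ θ′ → Algebra._≈_ (F/Δ a′) (ȟ h (fun ρ̄X θ′)) θ′
  ∂̄X∘ρ̄X θ′ = F′.≈-trans (F′.≈-sym (identify⁻¹∘identify _)) (F′.≈-trans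
      (fun-cong identify⁻¹ (LF.≈-trans (identify-∂̄X (fun ρ̄X θ′))
        (section (F/Δᵒ a) (fun identify θ′))))
      (identify⁻¹∘identify θ′))
    where
    module F′ = Algebra (F/Δ a′)
    module LF = Algebra (proj₁ (L.F₀ (F/Δᵒ a)))

  module _ {ρX : F (sig a′) → F (sig a)} (lifting : IsLifting ρX) where

    -- The left side is the value in `N` of `ȟ h (ρX θ′)`, a formula in the class of `θ′` in
    -- F(Σ′)/Δ′; `free` makes values in `N` depend on the class only.
    eval-reduct-ρX : ((N , _) : QVAlg a′) (v : ℕ → ∣ N ∣) → ∀ θ′ →
                     Algebra._≈_ N (eval (reduct morphism N) v (ρX θ′)) (eval N v θ′)
    eval-reduct-ρX Nᵒ@(N , _) v θ′ = ≈-trans (eval-ext morphism N v (ρX θ′))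
      (fun-cong (free a′ Nᵒ v)
        (F′.≈-trans (fun-cong (∂̄X h) (lifting θ′)) (∂̄X∘ρ̄X θ′)))
      where
      open Algebra N
      module F′ = Algebra (F/Δ a′)

    module _ (Mᵒ : QVAlg a) (v : ℕ → ∣ proj₁ Mᵒ ∣) where
      private
        M  = proj₁ Mᵒ
        LM = proj₁ (L.F₀ Mᵒ)
        module M = Algebra M

      -- Up to `identify`, this is what the adjunction assigns to `free Mᵒ v` followed by ∂̄_M, by
      -- naturality of the unit.
      transpose : AlgHom (F/Δ a′) LM
      transpose = Category._⊙_ (𝒬𝒱 a′) {F/Δᵒ a′} {L.F₀ (F/Δᵒ a)} {L.F₀ Mᵒ}
        (L.F₁ {F/Δᵒ a} {Mᵒ} (free a Mᵒ v)) identify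

      eval-ρX : ∀ θ′ → eval M v (ρX θ′) M.≈ fun (ρ̄.component Mᵒ) (fun transpose θ′)
      eval-ρX θ′ = M.≈-trans (fun-cong (free a Mᵒ v) (lifting θ′))
        (M.≈-sym (ρ̄.natural {F/Δᵒ a} {Mᵒ} (free a Mᵒ v) (fun identify θ′)))

      Solves-eval-ρX : ∀ {τ} θ′ → Solves M τ (eval M v (ρX θ′)) ⇔
        Solves LM (extEqs morphism τ) (eval LM (fun transpose ∘ var) θ′)
      Solves-eval-ρX θ′ = mk⇔
        -- ∂̄_M sends the value of `ρX θ′` to ∂̄_M(ρ̄_M(`transpose θ′`)), which `section` reduces to
        -- `transpose θ′`.
        (λ sol → Equivalence.to (Solves-reduct morphism LM)
          (Solves-resp-≈ hLM
            (LM.≈-trans (fun-cong (∂̄.component Mᵒ) (eval-ρX θ′))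
              (LM.≈-trans (section Mᵒ (fun transpose θ′)) transpose-eval))
            (Solves-hom (∂̄.component Mᵒ) sol)))
        (λ sol → Solves-resp-≈ M
          (M.≈-sym (M.≈-trans (eval-ρX θ′) (fun-cong (ρ̄.component Mᵒ) transpose-eval)))
          (Solves-hom (ρ̄.component Mᵒ)
            (Equivalence.from (Solves-reduct morphism LM) sol)))
        where
        module LM = Algebra LM
        hLM = reduct morphism LM
        transpose-eval : fun transpose θ′ LM.≈ eval LM (fun transpose ∘ var) θ′
        transpose-eval = free-unique a′ (L.F₀ Mᵒ) transpose θ′

corollary4p7 : ∀ {ℓ : Level} (a a′ : AlgebraizableLogic ℓ)
    (G : GlivenkoContext a a′)
    (ρX : F (AlgebraizableLogic.sig a′) → F (AlgebraizableLogic.sig a)) →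
    GlivenkoContext.IsLifting G ρX →
    (Γ′ : Pred (F (AlgebraizableLogic.sig a′)) ℓ) (φ′ : F (AlgebraizableLogic.sig a′)) →
    (AlgebraizableLogic._⊢_ a (image ρX Γ′) (ρX φ′) ⇔ AlgebraizableLogic._⊢_ a′ Γ′ φ′)
corollary4p7 a a′ G ρX lifting Γ′ φ′ = mk⇔
  (λ ρΓ′⊢ρφ′ → Equivalence.from char′ λ Nᵒ@(N , _) v H →
    let hN     = reduct morphism N
        value  = eval-reduct-ρX G lifting Nᵒ v in
    Equivalence.to (Solves-reduct morphism N) (Solves-resp-≈ hN (value φ′)
      -- The hypothesis is read in h⋆(`N`), under the same `v`.
      (Equivalence.to char ρΓ′⊢ρφ′ (Functor.F₀ (h⋆↾ h) Nᵒ) v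
        λ { (γ′ , γ′∈ , refl) → Solves-resp-≈ hN (Algebra.≈-sym N (value γ′))
              (Equivalence.from (Solves-reduct morphism N) (H γ′∈)) })))
  (λ Γ′⊢φ′ → Equivalence.from char λ Mᵒ v H →
    Equivalence.from (Solves-eval-ρX G lifting Mᵒ v φ′)
      -- The hypothesis is read in L_h(M), each variable taking the image of its class under
      -- `transpose`.
      (Equivalence.to char′ Γ′⊢φ′ (Functor.F₀ L Mᵒ) (fun (transpose G lifting Mᵒ v) ∘ var)
        λ {γ′} γ′∈ → Equivalence.to (Solves-eval-ρX G lifting Mᵒ v γ′)
          (H (γ′ , γ′∈ , refl))))
  where
  open GlivenkoContext G using (h; L)
  open _⟶_ h
  pair-a : IsAlgebraizingPair (logic a) (τ a) (Δ a)
  pair-a = _ , AlgebraizableLogic.algebraized a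
  char  = ⊢⇔QV-Solves a pair-a (image ρX Γ′) (ρX φ′)
  -- The pair for `a′` is the image under `h` of the pair for `a`, which is what lets
  -- `Solves-reduct` compare the two sides.
  char′ = ⊢⇔QV-Solves a′ (preserve (τ a) (Δ a) pair-a) Γ′ φ′
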